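{- For every integer $N\ge 1$, the total area of all ternary paths of length $3N$ equals $$\sum_{k=0}^{N-1}3^{k+1}\binom{3N-k}{N-1-k}.$$
   Context: A ternary path of length $3N$ is a lattice path $(0,c_0),(1,c_1),\dots,(3N,c_{3N})$ with $c_0=c_{3N}=0$, steps $(1,1)$ or $(1,-2)$, and all $c_j\ge 0$. Its area is $c_0+c_1+\cdots+c_{3N}$. The total area is the sum of the areas over all such paths of length $3N$. -}

module Defs where

open import Data.Nat as ℕ using (ℕ; zero; suc)
open import Data.Integer using (ℤ; +_; -[1+_]; _+_; _≤_; _≤?_; _≟_; 0ℤ)
open import Data.List as List using (List; _++_; filter)
open import Data.Vec using (Vec; []; _∷_; last; foldr′)
open import Data.Vec.Relation.Unary.All using (All; all?)
open import Data.Product using (_×_)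
open import Relation.Binary.PropositionalEquality using (_≡_)
open import Relation.Unary using (Decidable)
open import Relation.Nullary.Decidable using (_×-dec_)

data Step : Set where
  up down : Step

δ : Step → ℤ
δ up   = + 1
δ down = -[1+ 1 ]   -- i.e. -2

-- A path is encoded by its steps; heights c (s₁ ∷ … ∷ sₙ ∷ []) is the
-- sequence c₀, …, cₙ of its ordinates, with c₀ = c and cⱼ = cⱼ₋₁ + δ sⱼ.
heights : ∀ {n} → ℤ → Vec Step n → Vec ℤ (suc n)
heights c []       = c ∷ []
heights c (s ∷ ss) = c ∷ heights (c + δ s) ss

IsTernaryPath : ∀ {n} → Vec Step n → Set
IsTernaryPath w = last (heights 0ℤ w) ≡ 0ℤ × All (0ℤ ≤_) (heights 0ℤ w)

isTernaryPath? : ∀ {n} → Decidable (IsTernaryPath {n})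
isTernaryPath? w = (last (heights 0ℤ w) ≟ 0ℤ) ×-dec all? (0ℤ ≤?_) (heights 0ℤ w)

area : ∀ {n} → Vec Step n → ℤ
area w = foldr′ _+_ 0ℤ (heights 0ℤ w)

-- Every element of Vec Step n occurs exactly once in this list.
stepWords : ∀ n → List (Vec Step n)
stepWords zero    = [] List.∷ List.[]
stepWords (suc n) = List.map (up ∷_) (stepWords n) ++ List.map (down ∷_) (stepWords n)

ternaryPaths : ∀ N → List (Vec Step (3 ℕ.* N))
ternaryPaths N = filter isTernaryPath? (stepWords (3 ℕ.* N))

totalArea : ℕ → ℤ
totalArea N = List.foldr _+_ 0ℤ (List.map area (ternaryPaths N))

{-# OPTIONS --safe #-}

-- For a path with n steps, d of them down, ending at height h (so n = h + 3d),
-- appending the last step gives recurrences for the number p(n,h) of nonnegative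
-- paths from 0 to h and for their total area q(n,h):
--   p(n+1,h) = p(n,h-1) + p(n,h+2),
--   q(n+1,h) = q(n,h-1) + q(n,h+2) + h p(n+1,h),
-- with p = q = 0 at h = -1.  They are solved by
--   p(n,h)   = C(n,d) - 2 C(n,d-1),
--   2 q(n,h) = (h+1) (6 S(n,d) + h C(n+1,d)),
-- where S(n,d) = Σ_{k<d} 3^k C(n-k,d-1-k) obeys the Pascal rule.
-- The theorem is the case h = 0.
module Submission where

open import Data.Nat using (ℕ; _+_; _*_; _∸_; _^_; _≤_)
open import Data.Nat.Combinatorics using (_C_)
open import Data.Nat.ListAction using (sum)
open import Data.Integer using (+_)
open import Data.List using (map; upTo)
open import Relation.Binary.PropositionalEquality using (_≡_)
open import Defs

open import Data.Bool using (true; false; if_then_else_)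
open import Data.Integer as ℤ using (ℤ; -[1+_]; 0ℤ; 1ℤ; _⊖_)
import Data.Integer.Properties as ℤₚ
import Data.Integer.Tactic.RingSolver as ℤ-Solver
open import Data.List as List using (List; applyUpTo)
open import Data.List.Properties using (map-++; map-∘; map-upTo)
open import Data.Nat using (zero; suc; _<_; z≤n; s≤s)
open import Data.Nat.Combinatorics using (nCk+nC[k+1]≡[n+1]C[k+1])
open import Data.Nat.Properties using (suc-injective; +-identityʳ; +-suc; +-cancelˡ-≡; *-cancelˡ-≡; *-zeroʳ; m+n≡0⇒n≡0; ≤-trans; n≤1+n; m≤m+n)
open import Data.Nat.Tactic.RingSolver using (solve-∀)
open import Data.Product using (_×_; _,_)
open import Data.Vec using (Vec; []; _∷_; _∷ʳ_; last; foldr′)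
open import Data.Vec.Properties using (last-∷ʳ)
open import Data.Vec.Relation.Unary.All using (All; []; _∷_; all?)
open import Function using (_∘_; _⇔_; mk⇔)
open import Relation.Binary.PropositionalEquality using (refl; sym; trans; cong; cong₂; subst; _≗_; module ≡-Reasoning)
open import Relation.Nullary using (¬_; Dec; yes; no; does)
open import Relation.Nullary.Decidable using (_×-dec_; does-⇔; dec-false)
open import Relation.Unary using (Pred; Decidable)

open ≡-Reasoning

-- Sums over step words

∑ : List ℤ → ℤ
∑ = List.foldr ℤ._+_ 0ℤ

∑-++ : ∀ xs ys → ∑ (xs List.++ ys) ≡ ∑ xs ℤ.+ ∑ ys
∑-++ List.[]       ys = sym (ℤₚ.+-identityˡ _)
∑-++ (x List.∷ xs) ys = trans (cong (ℤ._+_ x) (∑-++ xs ys)) (sym (ℤₚ.+-assoc x _ _))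

∑-filter : ∀ {a p} {A : Set a} {P : Pred A p} (P? : Decidable P) (f : A → ℤ) xs →
           ∑ (map f (List.filter P? xs)) ≡ ∑ (map (λ x → if does (P? x) then f x else 0ℤ) xs)
∑-filter P? f List.[] = refl
∑-filter P? f (x List.∷ xs) with does (P? x)
... | true  = cong (ℤ._+_ (f x)) (∑-filter P? f xs)
... | false = trans (∑-filter P? f xs) (sym (ℤₚ.+-identityˡ _))

-- Recursion on the summand instead of on lists: once `filter` is traded for summands that vanish on
-- the excluded words, sums can be compared word by word.
sumWords : ∀ n → (Vec Step n → ℤ) → ℤ
sumWords zero    f = f []
sumWords (suc n) f = sumWords n (f ∘ (up ∷_)) ℤ.+ sumWords n (f ∘ (down ∷_))

∑-stepWords : ∀ n f → ∑ (map f (stepWords n)) ≡ sumWords n f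
∑-stepWords zero    f = ℤₚ.+-identityʳ (f [])
∑-stepWords (suc n) f = begin
  ∑ (map f (map (up ∷_) ws List.++ map (down ∷_) ws))               ≡⟨ cong ∑ (map-++ f (map (up ∷_) ws) (map (down ∷_) ws)) ⟩
  ∑ (map f (map (up ∷_) ws) List.++ map f (map (down ∷_) ws))       ≡⟨ ∑-++ (map f (map (up ∷_) ws)) _ ⟩
  ∑ (map f (map (up ∷_) ws)) ℤ.+ ∑ (map f (map (down ∷_) ws))       ≡⟨ cong₂ ℤ._+_ (branch up) (branch down) ⟩
  sumWords n (f ∘ (up ∷_)) ℤ.+ sumWords n (f ∘ (down ∷_))           ∎
  where
  ws = stepWords n
  branch : ∀ s → ∑ (map f (map (s ∷_) ws)) ≡ sumWords n (f ∘ (s ∷_))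
  branch s = trans (cong ∑ (sym (map-∘ ws))) (∑-stepWords n (f ∘ (s ∷_)))

sumWords-cong : ∀ n {f g} → f ≗ g → sumWords n f ≡ sumWords n g
sumWords-cong zero    f≗g = f≗g []
sumWords-cong (suc n) f≗g = cong₂ ℤ._+_ (sumWords-cong n (f≗g ∘ (up ∷_))) (sumWords-cong n (f≗g ∘ (down ∷_)))

sumWords-zero : ∀ n → sumWords n (λ _ → 0ℤ) ≡ 0ℤ
sumWords-zero zero    = refl
sumWords-zero (suc n) = cong₂ ℤ._+_ (sumWords-zero n) (sumWords-zero n)

sumWords-linear : ∀ n c f g →
  sumWords n (λ w → f w ℤ.+ c ℤ.* g w) ≡ sumWords n f ℤ.+ c ℤ.* sumWords n g
sumWords-linear zero    c f g = refl
sumWords-linear (suc n) c f g =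
  trans (cong₂ ℤ._+_ (sumWords-linear n c (f ∘ (up ∷_)) (g ∘ (up ∷_))) (sumWords-linear n c (f ∘ (down ∷_)) (g ∘ (down ∷_))))
        (rearrange (sumWords n _) (sumWords n _) (sumWords n _) (sumWords n _) c)
  where
  rearrange : ∀ a b x y c → (a ℤ.+ c ℤ.* b) ℤ.+ (x ℤ.+ c ℤ.* y) ≡ (a ℤ.+ x) ℤ.+ c ℤ.* (b ℤ.+ y)
  rearrange = ℤ-Solver.solve-∀

-- Words are generated by their first step, whereas the recurrences remove the last one. The two
-- splittings commute, so the induction only exchanges the two middle sums.
sumWords-∷ʳ : ∀ n f → sumWords (suc n) f ≡ sumWords n (f ∘ (_∷ʳ up)) ℤ.+ sumWords n (f ∘ (_∷ʳ down))
sumWords-∷ʳ zero    f = refl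
sumWords-∷ʳ (suc n) f =
  trans (cong₂ ℤ._+_ (sumWords-∷ʳ n (f ∘ (up ∷_))) (sumWords-∷ʳ n (f ∘ (down ∷_))))
        (interchange (sumWords n _) (sumWords n _) (sumWords n _) (sumWords n _))
  where
  interchange : ∀ a b x y → (a ℤ.+ b) ℤ.+ (x ℤ.+ y) ≡ (a ℤ.+ x) ℤ.+ (b ℤ.+ y)
  interchange = ℤ-Solver.solve-∀

a-b+b≡a : ∀ a b → a ℤ.- b ℤ.+ b ≡ a
a-b+b≡a = ℤ-Solver.solve-∀

-- Nonnegative paths ending at a given height

endpoint : ∀ {n} → ℤ → Vec Step n → ℤ
endpoint c w = last (heights c w)

heights-∷ʳ : ∀ {n} c (w : Vec Step n) s → heights c (w ∷ʳ s) ≡ heights c w ∷ʳ (endpoint c w ℤ.+ δ s)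
heights-∷ʳ c []       s = refl
heights-∷ʳ c (t ∷ ts) s = cong (c ∷_) (heights-∷ʳ (c ℤ.+ δ t) ts s)

endpoint-∷ʳ : ∀ {n} c (w : Vec Step n) s → endpoint c (w ∷ʳ s) ≡ endpoint c w ℤ.+ δ s
endpoint-∷ʳ c w s = trans (cong last (heights-∷ʳ c w s)) (last-∷ʳ _ (heights c w))

foldr′-+-∷ʳ : ∀ {n} (xs : Vec ℤ n) y → foldr′ ℤ._+_ 0ℤ (xs ∷ʳ y) ≡ foldr′ ℤ._+_ 0ℤ xs ℤ.+ y
foldr′-+-∷ʳ []       y = ℤₚ.+-comm y 0ℤ
foldr′-+-∷ʳ (x ∷ xs) y = trans (cong (ℤ._+_ x) (foldr′-+-∷ʳ xs y)) (sym (ℤₚ.+-assoc x _ y))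

area-∷ʳ : ∀ {n} (w : Vec Step n) s → area (w ∷ʳ s) ≡ area w ℤ.+ (endpoint 0ℤ w ℤ.+ δ s)
area-∷ʳ w s = trans (cong (foldr′ ℤ._+_ 0ℤ) (heights-∷ʳ 0ℤ w s)) (foldr′-+-∷ʳ (heights 0ℤ w) _)

All-∷ʳ⁺ : ∀ {a p} {A : Set a} {P : Pred A p} {n} {xs : Vec A n} {y} → All P xs → P y → All P (xs ∷ʳ y)
All-∷ʳ⁺ []         py = py ∷ []
All-∷ʳ⁺ (px ∷ pxs) py = px ∷ All-∷ʳ⁺ pxs py

All-∷ʳ⁻ : ∀ {a p} {A : Set a} {P : Pred A p} {n} (xs : Vec A n) {y} → All P (xs ∷ʳ y) → All P xs
All-∷ʳ⁻ []       _          = []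
All-∷ʳ⁻ (x ∷ xs) (px ∷ pxs) = px ∷ All-∷ʳ⁻ xs pxs

All-last : ∀ {a p} {A : Set a} {P : Pred A p} {n} (xs : Vec A (suc n)) → All P xs → P (last xs)
All-last (x ∷ [])     (px ∷ [])  = px
All-last (x ∷ y ∷ ys) (_  ∷ pxs) = All-last (y ∷ ys) pxs

EndsAt : ∀ {n} → ℤ → Vec Step n → Set
EndsAt h w = endpoint 0ℤ w ≡ h × All (0ℤ ℤ.≤_) (heights 0ℤ w)

endsAt? : ∀ {n} h (w : Vec Step n) → Dec (EndsAt h w)
endsAt? h w = (endpoint 0ℤ w ℤ.≟ h) ×-dec all? (0ℤ ℤ.≤?_) (heights 0ℤ w)

-- Since the prescribed final height is `+ h`, the appended height is automatically nonnegative, and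
-- the sign condition falls on `w` alone.
EndsAt-∷ʳ : ∀ {n} h (w : Vec Step n) s → EndsAt (+ h) (w ∷ʳ s) ⇔ EndsAt (+ h ℤ.- δ s) w
EndsAt-∷ʳ h w s = mk⇔ to from
  where
  to : EndsAt (+ h) (w ∷ʳ s) → EndsAt (+ h ℤ.- δ s) w
  to (end , nonneg) =
    trans (sym (a+b-b≡a (endpoint 0ℤ w) (δ s))) (cong (ℤ._- δ s) (trans (sym (endpoint-∷ʳ 0ℤ w s)) end)) ,
    All-∷ʳ⁻ (heights 0ℤ w) (subst (All (0ℤ ℤ.≤_)) (heights-∷ʳ 0ℤ w s) nonneg)
    where
    a+b-b≡a : ∀ a b → a ℤ.+ b ℤ.- b ≡ a
    a+b-b≡a = ℤ-Solver.solve-∀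
  from : EndsAt (+ h ℤ.- δ s) w → EndsAt (+ h) (w ∷ʳ s)
  from (end , nonneg) =
    trans (endpoint-∷ʳ 0ℤ w s) end′ ,
    subst (All (0ℤ ℤ.≤_)) (sym (heights-∷ʳ 0ℤ w s))
      (All-∷ʳ⁺ nonneg (subst (0ℤ ℤ.≤_) (sym end′) (ℤ.+≤+ z≤n)))
    where
    end′ : endpoint 0ℤ w ℤ.+ δ s ≡ + h
    end′ = trans (cong (ℤ._+ δ s) end) (a-b+b≡a (+ h) (δ s))

sumPaths : ∀ n → (Vec Step n → ℤ) → ℤ → ℤ
sumPaths n f h = sumWords n (λ w → if does (endsAt? h w) then f w else 0ℤ)

if-does-cong : ∀ {A : Set} (a? : Dec A) {x y z : ℤ} → (A → x ≡ y) →
               (if does a? then x else z) ≡ (if does a? then y else z)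
if-does-cong (yes a) x≡y = x≡y a
if-does-cong (no _)  _   = refl

sumPaths-cong : ∀ n {f g} h → (∀ w → EndsAt h w → f w ≡ g w) → sumPaths n f h ≡ sumPaths n g h
sumPaths-cong n h f≡g = sumWords-cong n (λ w → if-does-cong (endsAt? h w) (f≡g w))

sumPaths-shift : ∀ n f c h → sumPaths n (λ w → f w ℤ.+ c) h ≡ sumPaths n f h ℤ.+ c ℤ.* sumPaths n (λ _ → 1ℤ) h
sumPaths-shift n f c h = trans (sumWords-cong n (λ w → pointwise (does (endsAt? h w)) (f w))) (sumWords-linear n c _ _)
  where
  pointwise : ∀ b x → (if b then x ℤ.+ c else 0ℤ) ≡ (if b then x else 0ℤ) ℤ.+ c ℤ.* (if b then 1ℤ else 0ℤ)
  pointwise true  x = cong (ℤ._+_ x) (sym (ℤₚ.*-identityʳ c))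
  pointwise false _ = sym (trans (ℤₚ.+-identityˡ _) (ℤₚ.*-zeroʳ c))

-- `+ h ℤ.- δ s` computes to `h ⊖ 1` for `up` and to `+ (h + 2)` for `down`. At `h = 0` the former
-- is -1, so the boundary needs no separate clause here.
sumPaths-∷ʳ : ∀ n f h → sumPaths (suc n) f (+ h) ≡
              sumPaths n (f ∘ (_∷ʳ up)) (h ⊖ 1) ℤ.+ sumPaths n (f ∘ (_∷ʳ down)) (+ (h + 2))
sumPaths-∷ʳ n f h = trans (sumWords-∷ʳ n (λ w → if does (endsAt? (+ h) w) then f w else 0ℤ))
  (cong₂ ℤ._+_ (sumWords-cong n (last-step up)) (sumWords-cong n (last-step down)))
  where
  last-step : ∀ s w → (if does (endsAt? (+ h) (w ∷ʳ s)) then f (w ∷ʳ s) else 0ℤ) ≡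
              (if does (endsAt? (+ h ℤ.- δ s) w) then f (w ∷ʳ s) else 0ℤ)
  last-step s w = cong (if_then f (w ∷ʳ s) else 0ℤ)
    (does-⇔ (EndsAt-∷ʳ h w s) (endsAt? (+ h) (w ∷ʳ s)) (endsAt? (+ h ℤ.- δ s) w))

sumPaths-negative : ∀ n f j → sumPaths n f -[1+ j ] ≡ 0ℤ
sumPaths-negative n f j = trans (sumWords-cong n pointwise) (sumWords-zero n)
  where
  impossible : ∀ w → ¬ EndsAt -[1+ j ] w
  impossible w (end , nonneg) with () ← subst (0ℤ ℤ.≤_) end (All-last (heights 0ℤ w) nonneg)
  pointwise : ∀ w → (if does (endsAt? -[1+ j ] w) then f w else 0ℤ) ≡ 0ℤ
  pointwise w = cong (if_then f w else 0ℤ) (dec-false (endsAt? -[1+ j ] w) (impossible w))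

-- A step rises by at most 1: both heights that can precede the last step still exceed the remaining
-- length. This disposes of the predecessor at `h + 2` when d = 0.
sumPaths-too-high : ∀ n f h → n < h → sumPaths n f (+ h) ≡ 0ℤ
sumPaths-too-high zero    f (suc h) _         = refl
sumPaths-too-high (suc n) f (suc h) (s≤s n<h) =
  trans (sumPaths-∷ʳ n f (suc h))
        (cong₂ ℤ._+_ (sumPaths-too-high n _ h n<h)
                     (sumPaths-too-high n _ (suc h + 2) (≤-trans n<h (≤-trans (n≤1+n h) (m≤m+n (suc h) 2)))))

-- Path counts and total areas: recurrences in the last step

count : ℕ → ℤ → ℤ
count n = sumPaths n (λ _ → 1ℤ)

areaSum : ℕ → ℤ → ℤ
areaSum n = sumPaths n area

totalArea≡areaSum : ∀ N → totalArea N ≡ areaSum (3 * N) 0ℤ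
-- At height `0ℤ` the test `endsAt?` unfolds to the same decision as `isTernaryPath?`.
totalArea≡areaSum N = trans (∑-filter isTernaryPath? area (stepWords (3 * N))) (∑-stepWords (3 * N) _)

count-suc : ∀ n h → count (suc n) (+ h) ≡ count n (h ⊖ 1) ℤ.+ count n (+ (h + 2))
count-suc n h = sumPaths-∷ʳ n (λ _ → 1ℤ) h

-- Whichever step comes last, the final point contributes exactly `h` to the area, so all paths
-- together gain `h` times their number.
areaSum-suc : ∀ n h → areaSum (suc n) (+ h) ≡
              areaSum n (h ⊖ 1) ℤ.+ areaSum n (+ (h + 2)) ℤ.+ + h ℤ.* count (suc n) (+ h)
areaSum-suc n h = begin
  areaSum (suc n) (+ h)
    ≡⟨ sumPaths-∷ʳ n area h ⟩
  sumPaths n (area ∘ (_∷ʳ up)) (h ⊖ 1) ℤ.+ sumPaths n (area ∘ (_∷ʳ down)) (+ (h + 2))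
    ≡⟨ cong₂ ℤ._+_ (last-step up) (last-step down) ⟩
  (areaSum n (h ⊖ 1) ℤ.+ + h ℤ.* count n (h ⊖ 1)) ℤ.+ (areaSum n (+ (h + 2)) ℤ.+ + h ℤ.* count n (+ (h + 2)))
    ≡⟨ rearrange (areaSum n (h ⊖ 1)) (areaSum n (+ (h + 2))) (+ h) (count n (h ⊖ 1)) (count n (+ (h + 2))) ⟩
  areaSum n (h ⊖ 1) ℤ.+ areaSum n (+ (h + 2)) ℤ.+ + h ℤ.* (count n (h ⊖ 1) ℤ.+ count n (+ (h + 2)))
    ≡⟨ cong (λ c → areaSum n (h ⊖ 1) ℤ.+ areaSum n (+ (h + 2)) ℤ.+ + h ℤ.* c) (sym (count-suc n h)) ⟩
  areaSum n (h ⊖ 1) ℤ.+ areaSum n (+ (h + 2)) ℤ.+ + h ℤ.* count (suc n) (+ h)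
    ∎
  where
  rearrange : ∀ a b h c d → (a ℤ.+ h ℤ.* c) ℤ.+ (b ℤ.+ h ℤ.* d) ≡ a ℤ.+ b ℤ.+ h ℤ.* (c ℤ.+ d)
  rearrange = ℤ-Solver.solve-∀
  last-step : ∀ s → sumPaths n (area ∘ (_∷ʳ s)) (+ h ℤ.- δ s) ≡
              areaSum n (+ h ℤ.- δ s) ℤ.+ + h ℤ.* count n (+ h ℤ.- δ s)
  last-step s = trans
    (sumPaths-cong n (+ h ℤ.- δ s) λ w (end , _) → trans (area-∷ʳ w s)
      (cong (ℤ._+_ (area w)) (trans (cong (ℤ._+ δ s) end) (a-b+b≡a (+ h) (δ s)))))
    (sumPaths-shift n area (+ h) (+ h ℤ.- δ s))

-- Binomial identities

pascal : ∀ n k → suc n C suc k ≡ n C k + n C suc k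
pascal n k = sym (nCk+nC[k+1]≡[n+1]C[k+1] n k)

absorption : ∀ n k → suc k * (suc n C suc k) ≡ suc n * (n C k)
absorption zero    zero    = refl
absorption zero    (suc k) = *-zeroʳ (suc (suc k))
absorption (suc n) zero    = begin
  1 * (suc (suc n) C 1)            ≡⟨ cong (1 *_) (pascal (suc n) 0) ⟩
  1 * (1 + suc n C 1)              ≡⟨ step (suc n C 1) ⟩
  1 + 1 * (suc n C 1)              ≡⟨ cong (_+_ 1) (absorption n 0) ⟩
  1 + suc n * 1                    ∎
  where
  step : ∀ x → 1 * (1 + x) ≡ 1 + 1 * x
  step = solve-∀
absorption (suc n) (suc k) = begin
  suc (suc k) * (suc (suc n) C suc (suc k))
    ≡⟨ cong (suc (suc k) *_) (pascal (suc n) (suc k)) ⟩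
  suc (suc k) * (suc n C suc k + suc n C suc (suc k))
    -- One copy of the first binomial is split off, so that the induction hypothesis applies at both
    -- `k` and `suc k`.
    ≡⟨ expand k (suc n C suc k) (suc n C suc (suc k)) ⟩
  suc n C suc k + suc k * (suc n C suc k) + suc (suc k) * (suc n C suc (suc k))
    ≡⟨ cong₂ (λ x y → suc n C suc k + x + y) (absorption n k) (absorption n (suc k)) ⟩
  suc n C suc k + suc n * (n C k) + suc n * (n C suc k)
    ≡⟨ collect n (suc n C suc k) (n C k) (n C suc k) ⟩
  suc n C suc k + suc n * (n C k + n C suc k)
    ≡⟨ cong (λ x → suc n C suc k + suc n * x) (sym (pascal n k)) ⟩
  suc (suc n) * (suc n C suc k)
    ∎
  where
  expand : ∀ k a b → suc (suc k) * (a + b) ≡ a + suc k * a + suc (suc k) * b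
  expand = solve-∀
  collect : ∀ n a b c → a + suc n * b + suc n * c ≡ a + suc n * (b + c)
  collect = solve-∀

-- This makes the ballot number vanish at the barrier h = -1. As n + 1 = 3(d+1), absorption gives
-- C(n+1,d+1) = 3 C(n,d); Pascal's rule then removes one C(n,d).
central-ratio : ∀ n d → suc n ≡ 3 * suc d → n C suc d ≡ n C d + n C d
central-ratio n d eq = *-cancelˡ-≡ (n C suc d) (n C d + n C d) (suc d)
  (+-cancelˡ-≡ (suc d * (n C d)) _ _ (begin
    suc d * (n C d) + suc d * (n C suc d)       ≡⟨ factor d (n C d) (n C suc d) ⟩
    suc d * (n C d + n C suc d)                 ≡⟨ cong (suc d *_) (sym (pascal n d)) ⟩
    suc d * (suc n C suc d)                     ≡⟨ absorption n d ⟩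
    suc n * (n C d)                             ≡⟨ cong (_* (n C d)) eq ⟩
    3 * suc d * (n C d)                         ≡⟨ split d (n C d) ⟩
    suc d * (n C d) + suc d * (n C d + n C d)   ∎))
  where
  factor : ∀ d a b → suc d * a + suc d * b ≡ suc d * (a + b)
  factor = solve-∀
  split : ∀ d a → 3 * suc d * a ≡ suc d * a + suc d * (a + a)
  split = solve-∀

-- S n d is Σ_{k<d} 3^k C(n-k,d-1-k) for d ≤ n + 1 (see S-sum); this recurrence
-- makes the Pascal rule below hold without any restriction on n and d.
S : ℕ → ℕ → ℕ
S n zero    = 0
S n (suc d) = suc n C d + (S n d + S n d)

-- Unrolled, `S n d` is the sum of 2^(d-1-j) C(n+1,j) over j < d, a combination of binomials whose
-- weights depend only on d - j, so it inherits their Pascal rule.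
S-pascal : ∀ n d → S (suc n) (suc d) ≡ S n (suc d) + S n d
S-pascal n zero    = refl
S-pascal n (suc d) = begin
  suc (suc n) C suc d + (S (suc n) (suc d) + S (suc n) (suc d))
    ≡⟨ cong₂ (λ x y → x + (y + y)) (pascal (suc n) d) (S-pascal n d) ⟩
  (suc n C d + suc n C suc d) + ((S n (suc d) + S n d) + (S n (suc d) + S n d))
    ≡⟨ rearrange (suc n C d) (suc n C suc d) (S n (suc d)) (S n d) ⟩
  (suc n C suc d + (S n (suc d) + S n (suc d))) + (suc n C d + (S n d + S n d))
    ∎
  where
  rearrange : ∀ a b x y → (a + b) + ((x + y) + (x + y)) ≡ (b + (x + x)) + (a + (y + y))
  rearrange = solve-∀

S-sum : ∀ n m i (f : ℕ → ℕ) → m ≤ n → (∀ k → f k ≡ 3 ^ (k + i) * ((n ∸ k) C (m ∸ k))) →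
        sum (applyUpTo f (suc m)) ≡ 3 ^ i * S n (suc m)
S-sum n       zero    i f _         f≡ = trans (+-identityʳ (f 0)) (f≡ 0)
S-sum (suc n) (suc m) i f (s≤s m≤n) f≡ = begin
  f 0 + sum (applyUpTo (f ∘ suc) (suc m))
    ≡⟨ cong₂ _+_ (f≡ 0) (S-sum n m (suc i) (f ∘ suc) m≤n
         (λ k → trans (f≡ (suc k)) (cong (λ e → 3 ^ e * ((n ∸ k) C (m ∸ k))) (sym (+-suc k i))))) ⟩
  3 ^ i * (suc n C suc m) + 3 * 3 ^ i * S n (suc m)
    ≡⟨ collect (3 ^ i) (suc n C suc m) (S n (suc m)) ⟩
  3 ^ i * (S n (suc (suc m)) + S n (suc m))
    ≡⟨ cong (3 ^ i *_) (sym (S-pascal n (suc m))) ⟩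
  3 ^ i * S (suc n) (suc (suc m))
    ∎
  where
  collect : ∀ p a s → p * a + 3 * p * s ≡ p * ((a + (s + s)) + s)
  collect = solve-∀

-- Closed forms

-- For d ≥ 1, d times this number is (n + 1 - 3d) C(n,d-1). It can be negative once 3d exceeds n +
-- 1, hence the integer values.
ballot : ℕ → ℕ → ℤ
ballot n zero    = 1ℤ
ballot n (suc d) = + (n C suc d) ℤ.- + (n C d + n C d)

ballot-pascal : ∀ n d → ballot (suc n) (suc d) ≡ ballot n (suc d) ℤ.+ ballot n d
ballot-pascal n zero    = trans (cong (λ x → + x ℤ.- + 2) (pascal n 0)) (rearrange (+ (n C 1)))
  where
  rearrange : ∀ x → (+ 1 ℤ.+ x) ℤ.- + 2 ≡ (x ℤ.- + 2) ℤ.+ + 1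
  rearrange = ℤ-Solver.solve-∀
ballot-pascal n (suc d) =
  trans (cong₂ (λ x y → + x ℤ.- + (y + y)) (pascal n (suc d)) (pascal n d))
        (rearrange (+ (n C d)) (+ (n C suc d)) (+ (n C suc (suc d))))
  where
  rearrange : ∀ a b c → (b ℤ.+ c) ℤ.- ((a ℤ.+ b) ℤ.+ (a ℤ.+ b)) ≡ (c ℤ.- (b ℤ.+ b)) ℤ.+ (b ℤ.- (a ℤ.+ a))
  rearrange = ℤ-Solver.solve-∀

-- Undoing a final down step removes one step and one unit of d, and raises the height by 2.
down-index : ∀ n d h → suc (suc n) ≡ suc h + 3 * suc d → suc n ≡ suc (h + 2) + 3 * d
down-index n d h eq = trans (suc-injective eq) (rearrange d h)
  where
  rearrange : ∀ d h → h + 3 * suc d ≡ suc (h + 2) + 3 * d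
  rearrange = solve-∀

height-above : ∀ n h → suc (suc n) ≡ suc h + 3 * 0 → n < h + 2
height-above n h eq = subst (λ m → n < m + 2) (trans (suc-injective eq) (+-identityʳ h)) (m≤m+n (suc n) 2)

-- In both closed forms k is the final height plus one, so k ≡ 0 is the barrier.
count≡ballot : ∀ n d k → suc n ≡ k + 3 * d → count n (k ⊖ 1) ≡ ballot n d
-- At the barrier there are no paths, and `central-ratio` cancels the two terms of the formula.
count≡ballot n       (suc d) zero    eq = trans (sumPaths-negative n _ 0)
  (sym (trans (cong (λ x → + x ℤ.- + (n C d + n C d)) (central-ratio n d eq)) (ℤₚ.+-inverseʳ (+ (n C d + n C d)))))
count≡ballot zero    zero    (suc zero) eq = refl
count≡ballot zero    (suc d) (suc k) eq with () ← m+n≡0⇒n≡0 k (sym (suc-injective eq))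
count≡ballot (suc n) zero    (suc h) eq = trans (count-suc n h)
  (cong₂ ℤ._+_ (count≡ballot n zero h (suc-injective eq)) (sumPaths-too-high n _ (h + 2) (height-above n h eq)))
count≡ballot (suc n) (suc d) (suc h) eq = begin
  count (suc n) (+ h)                        ≡⟨ count-suc n h ⟩
  count n (h ⊖ 1) ℤ.+ count n (+ (h + 2))    ≡⟨ cong₂ ℤ._+_ (count≡ballot n (suc d) h (suc-injective eq))
                                                            (count≡ballot n d (suc (h + 2)) (down-index n d h eq)) ⟩
  ballot n (suc d) ℤ.+ ballot n d            ≡⟨ sym (ballot-pascal n d) ⟩
  ballot (suc n) (suc d)                     ∎

-- Doubling avoids halving h(h+1), and the factor `k` makes the right side vanish at the barrier.
-- Elsewhere the formula follows by induction from the area recurrence, with the count replaced by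
-- the ballot number.
areaSum-closed : ∀ n d k → suc n ≡ k + 3 * d →
  + 2 ℤ.* areaSum n (k ⊖ 1) ≡ + k ℤ.* (+ 6 ℤ.* + S n d ℤ.+ (k ⊖ 1) ℤ.* + (suc n C d))
areaSum-closed n       d       zero    eq = trans (cong (+ 2 ℤ.*_) (sumPaths-negative n area 0))
  (sym (ℤₚ.*-zeroˡ (+ 6 ℤ.* + S n d ℤ.+ -[1+ 0 ] ℤ.* + (suc n C d))))
areaSum-closed zero    zero    (suc zero) eq = refl
areaSum-closed zero    (suc d) (suc k) eq with () ← m+n≡0⇒n≡0 k (sym (suc-injective eq))
-- Only the all-up path remains; its doubled area is h(h+1).
areaSum-closed (suc n) zero    (suc h) eq = begin
  + 2 ℤ.* areaSum (suc n) (+ h)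
    ≡⟨ cong (+ 2 ℤ.*_) (areaSum-suc n h) ⟩
  + 2 ℤ.* (areaSum n (h ⊖ 1) ℤ.+ areaSum n (+ (h + 2)) ℤ.+ + h ℤ.* count (suc n) (+ h))
    ≡⟨ cong₂ (λ x y → + 2 ℤ.* (areaSum n (h ⊖ 1) ℤ.+ x ℤ.+ + h ℤ.* y))
         (sumPaths-too-high n area (h + 2) (height-above n h eq)) (count≡ballot (suc n) 0 (suc h) eq) ⟩
  + 2 ℤ.* (areaSum n (h ⊖ 1) ℤ.+ 0ℤ ℤ.+ + h ℤ.* 1ℤ)
    ≡⟨ distribute (areaSum n (h ⊖ 1)) (+ h) ⟩
  + 2 ℤ.* areaSum n (h ⊖ 1) ℤ.+ + 2 ℤ.* + h
    ≡⟨ cong (ℤ._+ + 2 ℤ.* + h) (areaSum-closed n zero h (suc-injective eq)) ⟩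
  + h ℤ.* (+ 6 ℤ.* 0ℤ ℤ.+ (+ h ℤ.- 1ℤ) ℤ.* 1ℤ) ℤ.+ + 2 ℤ.* + h
    ≡⟨ collect (+ h) ⟩
  (1ℤ ℤ.+ + h) ℤ.* (+ 6 ℤ.* 0ℤ ℤ.+ + h ℤ.* 1ℤ)
    ∎
  where
  distribute : ∀ q h → + 2 ℤ.* (q ℤ.+ 0ℤ ℤ.+ h ℤ.* 1ℤ) ≡ + 2 ℤ.* q ℤ.+ + 2 ℤ.* h
  distribute = ℤ-Solver.solve-∀
  collect : ∀ h → h ℤ.* (+ 6 ℤ.* 0ℤ ℤ.+ (h ℤ.- 1ℤ) ℤ.* 1ℤ) ℤ.+ + 2 ℤ.* h ≡ (1ℤ ℤ.+ h) ℤ.* (+ 6 ℤ.* 0ℤ ℤ.+ h ℤ.* 1ℤ)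
  collect = ℤ-Solver.solve-∀
areaSum-closed (suc n) (suc d) (suc h) eq = begin
  + 2 ℤ.* areaSum (suc n) (+ h)
    ≡⟨ cong (+ 2 ℤ.*_) (areaSum-suc n h) ⟩
  + 2 ℤ.* (areaSum n (h ⊖ 1) ℤ.+ areaSum n (+ (h + 2)) ℤ.+ + h ℤ.* count (suc n) (+ h))
    ≡⟨ distribute (areaSum n (h ⊖ 1)) (areaSum n (+ (h + 2))) (+ h ℤ.* count (suc n) (+ h)) ⟩
  + 2 ℤ.* areaSum n (h ⊖ 1) ℤ.+ + 2 ℤ.* areaSum n (+ (h + 2)) ℤ.+ + 2 ℤ.* (+ h ℤ.* count (suc n) (+ h))
    ≡⟨ cong₂ (λ x y → x ℤ.+ y ℤ.+ + 2 ℤ.* (+ h ℤ.* count (suc n) (+ h)))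
         (areaSum-closed n (suc d) h (suc-injective eq))
         (areaSum-closed n d (suc (h + 2)) (down-index n d h eq)) ⟩
  -- `S n (suc d)` unfolds by definition to `b ℤ.+ (s ℤ.+ s)`, so both predecessors are expressed in
  -- the same `a`, `b`, `s`.
  H ℤ.* (+ 6 ℤ.* (b ℤ.+ (s ℤ.+ s)) ℤ.+ (H ℤ.- 1ℤ) ℤ.* a)
    ℤ.+ (1ℤ ℤ.+ (H ℤ.+ + 2)) ℤ.* (+ 6 ℤ.* s ℤ.+ (H ℤ.+ + 2) ℤ.* b)
    ℤ.+ + 2 ℤ.* (H ℤ.* count (suc n) (+ h))
    ≡⟨ cong (λ x → H ℤ.* (+ 6 ℤ.* (b ℤ.+ (s ℤ.+ s)) ℤ.+ (H ℤ.- 1ℤ) ℤ.* a)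
                   ℤ.+ (1ℤ ℤ.+ (H ℤ.+ + 2)) ℤ.* (+ 6 ℤ.* s ℤ.+ (H ℤ.+ + 2) ℤ.* b)
                   ℤ.+ + 2 ℤ.* (H ℤ.* x))
         (count≡ballot (suc n) (suc d) (suc h) eq) ⟩
  H ℤ.* (+ 6 ℤ.* (b ℤ.+ (s ℤ.+ s)) ℤ.+ (H ℤ.- 1ℤ) ℤ.* a)
    ℤ.+ (1ℤ ℤ.+ (H ℤ.+ + 2)) ℤ.* (+ 6 ℤ.* s ℤ.+ (H ℤ.+ + 2) ℤ.* b)
    ℤ.+ + 2 ℤ.* (H ℤ.* (a ℤ.- (b ℤ.+ b)))
    -- On both sides the coefficients of `a`, `b`, `s` are H(H+1), (H+1)(H+6) and 18(H+1).
    ≡⟨ collect H a b s ⟩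
  (1ℤ ℤ.+ H) ℤ.* (+ 6 ℤ.* ((b ℤ.+ (s ℤ.+ s)) ℤ.+ s) ℤ.+ H ℤ.* (b ℤ.+ a))
    ≡⟨ cong₂ (λ x y → (1ℤ ℤ.+ H) ℤ.* (+ 6 ℤ.* + x ℤ.+ H ℤ.* + y)) (sym (S-pascal n d)) (sym (pascal (suc n) d)) ⟩
  + suc h ℤ.* (+ 6 ℤ.* + S (suc n) (suc d) ℤ.+ + h ℤ.* + (suc (suc n) C suc d))
    ∎
  where
  H = + h
  a = + (suc n C suc d)
  b = + (suc n C d)
  s = + S n d
  distribute : ∀ x y z → + 2 ℤ.* (x ℤ.+ y ℤ.+ z) ≡ + 2 ℤ.* x ℤ.+ + 2 ℤ.* y ℤ.+ + 2 ℤ.* z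
  distribute = ℤ-Solver.solve-∀
  collect : ∀ H a b s →
    H ℤ.* (+ 6 ℤ.* (b ℤ.+ (s ℤ.+ s)) ℤ.+ (H ℤ.- 1ℤ) ℤ.* a)
      ℤ.+ (1ℤ ℤ.+ (H ℤ.+ + 2)) ℤ.* (+ 6 ℤ.* s ℤ.+ (H ℤ.+ + 2) ℤ.* b)
      ℤ.+ + 2 ℤ.* (H ℤ.* (a ℤ.- (b ℤ.+ b)))
    ≡ (1ℤ ℤ.+ H) ℤ.* (+ 6 ℤ.* ((b ℤ.+ (s ℤ.+ s)) ℤ.+ s) ℤ.+ H ℤ.* (b ℤ.+ a))
  collect = ℤ-Solver.solve-∀

-- Specialization to final height 0

totalArea≡3*S : ∀ N → totalArea N ≡ + (3 * S (3 * N) N)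
totalArea≡3*S N = ℤₚ.*-cancelˡ-≡ (+ 2) _ _ (begin
  + 2 ℤ.* totalArea N                                   ≡⟨ cong (+ 2 ℤ.*_) (totalArea≡areaSum N) ⟩
  -- Final height 0 means k = 1, with N down steps; the binomial term then carries the factor 0.
  + 2 ℤ.* areaSum (3 * N) 0ℤ                            ≡⟨ areaSum-closed (3 * N) N 1 refl ⟩
  1ℤ ℤ.* (+ 6 ℤ.* s ℤ.+ 0ℤ ℤ.* + (suc (3 * N) C N))     ≡⟨ simplify s (+ (suc (3 * N) C N)) ⟩
  + 2 ℤ.* (+ 3 ℤ.* s)                                   ≡⟨ cong (+ 2 ℤ.*_) (sym (ℤₚ.pos-* 3 (S (3 * N) N))) ⟩
  + 2 ℤ.* + (3 * S (3 * N) N)                           ∎)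
  where
  s = + S (3 * N) N
  simplify : ∀ s c → 1ℤ ℤ.* (+ 6 ℤ.* s ℤ.+ 0ℤ ℤ.* c) ≡ + 2 ℤ.* (+ 3 ℤ.* s)
  simplify = ℤ-Solver.solve-∀

mainTheorem3 : (N : ℕ) → 1 ≤ N →
    totalArea N ≡ + sum (map (λ k → 3 ^ (k + 1) * ((3 * N ∸ k) C (N ∸ 1 ∸ k))) (upTo N))
mainTheorem3 (suc m) _ = trans (totalArea≡3*S (suc m)) (cong +_ (sym (trans
  (cong sum (map-upTo _ (suc m)))
  -- Offset 1 matches the exponent `k + 1`, and `3 ^ 1` is the factor 3 of `totalArea≡3*S`.
  (S-sum (3 * suc m) m 1 _ (≤-trans (n≤1+n m) (m≤m+n (suc m) _)) (λ _ → refl)))))
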